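{- Let $n$ and $r$ be positive integers with $1 \le r < n$. Then the circulant graph $C(2n,r)$ is singular if and only if $\gcd(n, 2r+1) \ge 3$.
   Context: A graph is called singular if its adjacency matrix is singular. For a positive integer $m \ge 3$, $C_m$ denotes the cycle graph on $m$ vertices. For $1 \le r < \lfloor m/2 \rfloor$, $C_m^{(r)}$ is the graph with the same vertex set as $C_m$ in which two distinct vertices $x,y$ are adjacent exactly when the distance between $x$ and $y$ in $C_m$ is at most $r$. The graph $C_{2n}^{n}$ is the graph on the vertex set of $C_{2n}$ in which two vertices are adjacent exactly when their distance in $C_{2n}$ equals $n$. For $1 \le r < n$, $C(2n,r)$ is the graph on $2n$ vertices whose adjacency matrix is the sum of the adjacency matrices of $C_{2n}^{(r)}$ and $C_{2n}^{n}$; equivalently, its adjacency matrix is the circulant matrix (each row is the cyclic shift of the previous one by one position to the right) with first row $[0, \underbrace{1,\ldots,1}_{r}, \underbrace{0,\ldots,0}_{n-r-1}, 1, \underbrace{0,\ldots,0}_{n-r-1}, \underbrace{1,\ldots,1}_{r}]$. -}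

module Defs where

open import Data.Bool using (if_then_else_)
open import Data.Fin using (Fin; toℕ; _≟_)
open import Data.Fin.Properties using (any?)
open import Data.Nat using (ℕ; zero; suc; _*_; _≤_; _<_; s≤s; s≤s⁻¹; z<s)
import Data.Nat as ℕ
import Data.Nat.Properties as ℕ
open import Data.Product using (∃; _×_; _,_)
open import Data.Rational using (ℚ; 0ℚ; 1ℚ)
import Data.Rational as ℚ
import Data.Rational.Properties as ℚ
open import Data.Sum using (_⊎_; inj₁; inj₂; swap; [_,_]′)
open import Data.Vec.Functional using (Vector)
open import Relation.Binary.Definitions using (tri<; tri≈; tri>)
open import Relation.Binary.PropositionalEquality
open import Relation.Nullary
  using (¬_; Dec; yes; no; does; ¬?; _×-dec_; _⊎-dec_; contradiction)
open import Relation.Nullary.Decidable using (map′)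
open import Algebra.Bundles using (CommutativeRing)
open import Algebra.Properties.Semiring.Sum
  (CommutativeRing.semiring ℚ.+-*-commutativeRing) using (sum)

-- Entries are rational: a rational matrix is invertible over ℝ or ℂ
-- exactly when it is invertible over ℚ.
Matrix : ℕ → Set
Matrix m = Vector (Vector ℚ m) m

infix  4 _≈ᴹ_
infixl 6 _+ᴹ_
infixl 7 _*ᴹ_

_≈ᴹ_ : ∀ {m} → Matrix m → Matrix m → Set
A ≈ᴹ B = ∀ i j → A i j ≡ B i j

_+ᴹ_ : ∀ {m} → Matrix m → Matrix m → Matrix m
(A +ᴹ B) i j = A i j ℚ.+ B i j

_*ᴹ_ : ∀ {m} → Matrix m → Matrix m → Matrix m
(A *ᴹ B) i j = sum λ k → A i k ℚ.* B k j

1ᴹ : ∀ {m} → Matrix m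
1ᴹ i j = if does (i ≟ j) then 1ℚ else 0ℚ

Invertible : ∀ {m} → Matrix m → Set
Invertible A = ∃ λ B → A *ᴹ B ≈ᴹ 1ᴹ × B *ᴹ A ≈ᴹ 1ᴹ

SingularMatrix : ∀ {m} → Matrix m → Set
SingularMatrix A = ¬ Invertible A

record Graph (m : ℕ) : Set₁ where
  field
    Adj        : Fin m → Fin m → Set
    adj?       : ∀ x y → Dec (Adj x y)
    adj-sym    : ∀ {x y} → Adj x y → Adj y x
    adj-irrefl : ∀ {x} → ¬ Adj x x

open Graph public

adjacencyMatrix : ∀ {m} → Graph m → Matrix m
adjacencyMatrix G x y = if does (adj? G x y) then 1ℚ else 0ℚ

Singular : ∀ {m} → Graph m → Set
Singular G = SingularMatrix (adjacencyMatrix G)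

module _ {m} (G : Graph m) where

  -- The natural number is the number of edges.
  Walk : ℕ → Fin m → Fin m → Set
  Walk zero    x y = x ≡ y
  Walk (suc k) x y = ∃ λ z → Adj G x z × Walk k z y

  IsDistance : ℕ → Fin m → Fin m → Set
  IsDistance d x y = Walk d x y × (∀ {k} → k < d → ¬ Walk k x y)

  DistanceAtMost : ℕ → Fin m → Fin m → Set
  DistanceAtMost r x y = ∃ λ d → d ≤ r × IsDistance d x y

  walk? : ∀ k x y → Dec (Walk k x y)
  walk? zero    x y = x ≟ y
  walk? (suc k) x y = any? λ z → adj? G x z ×-dec walk? k z y

  walk-snoc : ∀ k {x y z} → Walk k x y → Adj G y z → Walk (suc k) x z
  walk-snoc zero    refl         yz = _ , yz , refl
  walk-snoc (suc k) (w , xw , p) yz = w , xw , walk-snoc k p yz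

  walk-sym : ∀ k {x y} → Walk k x y → Walk k y x
  walk-sym zero    p            = sym p
  walk-sym (suc k) (z , xz , p) = walk-snoc k (walk-sym k p) (adj-sym G xz)

  isDistance? : ∀ d x y → Dec (IsDistance d x y)
  isDistance? d x y =
    walk? d x y ×-dec ℕ.allUpTo? (λ k → ¬? (walk? k x y)) d

  isDistance-sym : ∀ {d x y} → IsDistance d x y → IsDistance d y x
  isDistance-sym {d} (p , min) = walk-sym d p , λ {k} k<d q → min k<d (walk-sym k q)

  isDistance-unique : ∀ {d e x y} → IsDistance d x y → IsDistance e x y → d ≡ e
  isDistance-unique {d} {e} (p , minᵈ) (q , minᵉ) with ℕ.<-cmp d e
  ... | tri< d<e _ _ = contradiction p (minᵉ d<e)
  ... | tri≈ _ d≡e _ = d≡e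
  ... | tri> _ _ e<d = contradiction q (minᵈ e<d)

  distanceAtMost? : ∀ r x y → Dec (DistanceAtMost r x y)
  distanceAtMost? r x y =
    map′ (λ (d , d<1+r , p) → d , s≤s⁻¹ d<1+r , p)
         (λ (d , d≤r , p) → d , s≤s d≤r , p)
         (ℕ.anyUpTo? (λ d → isDistance? d x y) (suc r))

powerGraph : ∀ {m} → Graph m → ℕ → Graph m
powerGraph G r = record
  { Adj        = λ x y → x ≢ y × DistanceAtMost G r x y
  ; adj?       = λ x y → ¬? (x ≟ y) ×-dec distanceAtMost? G r x y
  ; adj-sym    = λ (x≢y , d , d≤r , p) → ≢-sym x≢y , d , d≤r , isDistance-sym G p
  ; adj-irrefl = λ (x≢x , _) → x≢x refl
  }

distanceGraph : ∀ {m} → Graph m → (d : ℕ) → 0 < d → Graph m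
distanceGraph G d 0<d = record
  { Adj        = IsDistance G d
  ; adj?       = isDistance? G d
  ; adj-sym    = isDistance-sym G
  ; adj-irrefl = λ (_ , min) → min 0<d refl
  }

infixr 6 _∪ᴳ_

_∪ᴳ_ : ∀ {m} → Graph m → Graph m → Graph m
G ∪ᴳ H = record
  { Adj        = λ x y → Adj G x y ⊎ Adj H x y
  ; adj?       = λ x y → adj? G x y ⊎-dec adj? H x y
  ; adj-sym    = λ { (inj₁ p) → inj₁ (adj-sym G p) ; (inj₂ p) → inj₂ (adj-sym H p) }
  ; adj-irrefl = [ adj-irrefl G , adj-irrefl H ]′
  }

∪ᴳ-adjacencyMatrix : ∀ {m} (G H : Graph m) →
  (∀ {x y} → Adj G x y → ¬ Adj H x y) →
  adjacencyMatrix (G ∪ᴳ H) ≈ᴹ adjacencyMatrix G +ᴹ adjacencyMatrix H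
∪ᴳ-adjacencyMatrix G H disjoint x y with adj? G x y | adj? H x y
... | yes p | yes q = contradiction q (disjoint p)
... | yes _ | no _  = refl
... | no _  | yes _ = refl
... | no _  | no _  = refl

-- y is the cyclic successor of x in 0 → 1 → ⋯ → m-1 → 0.
Next : ∀ {m} → Fin m → Fin m → Set
Next {m} x y = toℕ y ≡ suc (toℕ x) ⊎ (suc (toℕ x) ≡ m × toℕ y ≡ 0)

next? : ∀ {m} (x y : Fin m) → Dec (Next x y)
next? {m} x y =
  (toℕ y ℕ.≟ suc (toℕ x)) ⊎-dec ((suc (toℕ x) ℕ.≟ m) ×-dec (toℕ y ℕ.≟ 0))

next-irrefl : ∀ {m} → 3 ≤ m → {x : Fin m} → ¬ Next x x
next-irrefl 3≤m (inj₁ x≡1+x) = ℕ.1+n≢n (sym x≡1+x)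
next-irrefl 3≤m (inj₂ (1+x≡m , x≡0)) with trans (sym 1+x≡m) (cong suc x≡0)
next-irrefl (s≤s ()) _ | refl

cycle : (m : ℕ) → 3 ≤ m → Graph m
cycle m 3≤m = record
  { Adj        = λ x y → Next x y ⊎ Next y x
  ; adj?       = λ x y → next? x y ⊎-dec next? y x
  ; adj-sym    = swap
  ; adj-irrefl = [ next-irrefl 3≤m , next-irrefl 3≤m ]′
  }

module _ (n r : ℕ) (1≤r : 1 ≤ r) (r<n : r < n) where

  private
    2≤n : 2 ≤ n
    2≤n = ℕ.≤-trans (s≤s 1≤r) r<n

    3≤2n : 3 ≤ 2 * n
    3≤2n = ℕ.≤-trans (ℕ.n≤1+n 3) (ℕ.*-monoʳ-≤ 2 2≤n)

    0<n : 0 < n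
    0<n = ℕ.≤-trans z<s r<n

  C₂ₙ : Graph (2 * n)
  C₂ₙ = cycle (2 * n) 3≤2n

  C₂ₙ⁽ʳ⁾ : Graph (2 * n)
  C₂ₙ⁽ʳ⁾ = powerGraph C₂ₙ r

  C₂ₙⁿ : Graph (2 * n)
  C₂ₙⁿ = distanceGraph C₂ₙ n 0<n

  C[2n,r] : Graph (2 * n)
  C[2n,r] = C₂ₙ⁽ʳ⁾ ∪ᴳ C₂ₙⁿ

  -- The union is edge-disjoint, so it is the graph whose adjacency
  -- matrix is the sum of the two adjacency matrices.
  C[2n,r]-adjacencyMatrix :
    adjacencyMatrix C[2n,r] ≈ᴹ adjacencyMatrix C₂ₙ⁽ʳ⁾ +ᴹ adjacencyMatrix C₂ₙⁿ
  C[2n,r]-adjacencyMatrix = ∪ᴳ-adjacencyMatrix C₂ₙ⁽ʳ⁾ C₂ₙⁿ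
    λ (_ , d , d≤r , p) q →
      ℕ.<⇒≱ r<n (subst (_≤ r) (isDistance-unique C₂ₙ p q) d≤r)

{-# OPTIONS --safe #-}

-- Write T for the shift of 2n-periodic sequences and L = 2r + 1. The adjacency matrix of
-- C(2n,r) acts as A = T⁻ʳ(1 + T + ⋯ + T²ʳ) − 1 + Tⁿ.
--
-- If d = gcd(n,L) ≥ 3, a d-periodic sequence of the form g − Tg is killed by A: the window
-- sum telescopes to zero because d ∣ L, and Tⁿ acts as 1 because d ∣ n.
--
-- Otherwise L is prime to 4n, since it is odd. Modulo 2 the operator Tⁿ − 1 squares to zero,
-- so A is a unipotent perturbation of the window sum, whose inverse comes from an inverse of
-- L modulo 4n. So A has a right inverse modulo 2 among the integral operators, say
-- AB = 1 + 2C; such an operator has odd determinant, hence A is invertible over ℚ.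
module Submission where

open import Defs
open import Algebra.Bundles using (CommutativeRing)
open import Algebra.Properties.Group using (∙-cancelˡ)
open import Data.Bool using (if_then_else_)
open import Data.Fin using (Fin; zero; suc; toℕ)
import Data.Fin.Properties as Fin
open import Data.Integer using (ℤ; -[1+_]; 0ℤ; 1ℤ)
import Data.Integer as ℤ
import Data.Integer.Properties as ℤ
open import Data.Nat
  using (ℕ; zero; suc; _≤_; _<_; z≤n; s≤s; z<s; s<s; NonZero; >-nonZero; >-nonZero⁻¹)
import Data.Nat as ℕ
open import Data.Nat.Coprimality as Coprimality using (Coprime; coprime-Bézout; coprime-divisor)
open import Data.Nat.Divisibility
  using (_∣_; _∣?_; _∣0; ∣1⇒≡1; ∣⇒≤; ∣-trans; m∣m*n; ∣m⇒∣m*n; ∣m∣n⇒∣m+n; ∣m+n∣m⇒∣n)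
import Data.Nat.DivMod as ℕ
open import Data.Nat.GCD
  using (gcd; gcd[m,n]∣m; gcd[m,n]∣n; gcd-greatest; gcd[m,n]≡0⇒n≡0; module Bézout)
import Data.Nat.Properties as ℕ
import Data.Nat.Tactic.RingSolver as ℕ
open import Data.Product using (∃; ∃₂; _×_; _,_; proj₁; proj₂)
open import Data.Rational using (ℚ; mkℚ; 0ℚ; 1ℚ; _+_; _*_; -_; _-_; _/_; 1/_; ≢-nonZero; ↥_)
import Data.Rational.Properties as ℚ
open import Data.Rational.Solver using (module +-*-Solver)
open import Data.Sum using (_⊎_; inj₁; inj₂; [_,_]′)
open import Data.Vec.Functional using (Vector; tail) renaming (_∷_ to _∷ᵛ_)
open import Function using (_∘_)
open import Function.Bundles using (_⇔_; mk⇔)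
open import Relation.Binary.PropositionalEquality
open import Relation.Nullary using (¬_; does; yes; no; contradiction)
open import Relation.Nullary.Decidable using (dec-true; dec-false; decidable-stable)
open import Algebra.Properties.Semiring.Sum
  (CommutativeRing.semiring ℚ.+-*-commutativeRing)
open +-*-Solver using (solve; _:=_; _:+_; _:*_; :-_; _:-_; con)
open ≡-Reasoning

-- Linear systems that are the identity modulo 2

ι : ℤ → ℚ
ι z = z / 1

-- `z / 1` is normalised through a gcd that does not reduce for a variable `z`. On the `mkℚ` form
-- addition and multiplication unfold to an integer numerator over 1.
ι≡mkℚ : ∀ z → ι z ≡ mkℚ z 0 (Coprimality.sym (Coprimality.1-coprimeTo _))
ι≡mkℚ z = ℚ.↥p/↧p≡p (mkℚ z 0 _)

ι-+ : ∀ y z → ι (y ℤ.+ z) ≡ ι y + ι z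
ι-+ y z = begin
  (y ℤ.+ z) / 1                    ≡⟨ cong (_/ 1) (cong₂ ℤ._+_ (ℤ.*-identityʳ y) (ℤ.*-identityʳ z)) ⟨
  (y ℤ.* 1ℤ ℤ.+ z ℤ.* 1ℤ) / 1      ≡⟨ cong₂ _+_ (ι≡mkℚ y) (ι≡mkℚ z) ⟨
  ι y + ι z                        ∎

ι-* : ∀ y z → ι (y ℤ.* z) ≡ ι y * ι z
ι-* y z = sym (cong₂ _*_ (ι≡mkℚ y) (ι≡mkℚ z))

1+z+z-invertible : ∀ z → ∃ λ q → q * (1ℚ + (ι z + ι z)) ≡ 1ℚ
1+z+z-invertible z = 1/ a , trans (cong (1/ a *_) (sym a≡)) (ℚ.*-inverseˡ a)
  where
  w = 1ℤ ℤ.+ (z ℤ.+ z)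

  a = mkℚ w 0 (Coprimality.sym (Coprimality.1-coprimeTo _))

  a≡ : a ≡ 1ℚ + (ι z + ι z)
  a≡ = trans (sym (ι≡mkℚ w)) (trans (ι-+ 1ℤ (z ℤ.+ z)) (cong (_+_ 1ℚ) (ι-+ z z)))

  odd : ∀ z → 1ℤ ℤ.+ (z ℤ.+ z) ≢ 0ℤ
  odd (ℤ.+ n) ()
  odd -[1+ n ] ()

  instance
    a≢0 = ≢-nonZero {a} λ a≡0 → odd z (cong ↥_ {x = a} a≡0)

-- Integrality is a property of the functional rather than an integer matrix, so that it can be
-- established by closure for operators built from sums and differences of coordinates.
IsIntegral : ∀ {m} → (Vector ℚ m → ℚ) → Set
IsIntegral {m} φ = ∃ λ (k : Vector ℤ m) → ∀ x → φ x ≡ sum λ j → ι (k j) * x j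

zero-isIntegral : ∀ {m} → IsIntegral {m} (λ _ → 0ℚ)
zero-isIntegral {m} = (λ _ → 0ℤ) , λ x → sym (trans
  (sum-cong-≗ (λ j → ℚ.*-zeroˡ (x j))) (sum-replicate-zero m))

lookup-isIntegral : ∀ {m} (i : Fin m) → IsIntegral (λ x → x i)
lookup-isIntegral zero = (1ℤ ∷ᵛ λ _ → 0ℤ) , λ x → sym (begin
  1ℚ * x zero + sum (λ j → 0ℚ * x (suc j))
    ≡⟨ cong₂ _+_ (ℚ.*-identityˡ (x zero)) (sym (proj₂ zero-isIntegral (tail x))) ⟩
  x zero + 0ℚ                               ≡⟨ ℚ.+-identityʳ _ ⟩
  x zero                                    ∎)
lookup-isIntegral (suc i) with lookup-isIntegral i
... | k , φ≡ = (0ℤ ∷ᵛ k) , λ x → trans (φ≡ (tail x)) (sym (begin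
  0ℚ * x zero + sum (λ j → ι (k j) * x (suc j))
    ≡⟨ cong (_+ sum (λ j → ι (k j) * x (suc j))) (ℚ.*-zeroˡ (x zero)) ⟩
  0ℚ + sum (λ j → ι (k j) * x (suc j))           ≡⟨ ℚ.+-identityˡ _ ⟩
  sum (λ j → ι (k j) * x (suc j))                ∎))

+-isIntegral : ∀ {m} {φ ψ : Vector ℚ m → ℚ} →
  IsIntegral φ → IsIntegral ψ → IsIntegral (λ x → φ x + ψ x)
+-isIntegral (k , φ≡) (l , ψ≡) = (λ j → k j ℤ.+ l j) , λ x → trans
  (cong₂ _+_ (φ≡ x) (ψ≡ x))
  (trans (sym (∑-distrib-+ (λ j → ι (k j) * x j) (λ j → ι (l j) * x j)))
    (sum-cong-≗ λ j → trans (sym (ℚ.*-distribʳ-+ (x j) (ι (k j)) (ι (l j))))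
      (cong (_* x j) (sym (ι-+ (k j) (l j))))))

*-isIntegral : ∀ {m} {φ : Vector ℚ m → ℚ} z →
  IsIntegral φ → IsIntegral (λ x → ι z * φ x)
*-isIntegral z (k , φ≡) = (λ j → z ℤ.* k j) , λ x → trans
  (cong (ι z *_) (φ≡ x))
  (trans (*-distribˡ-sum (ι z) (λ j → ι (k j) * x j))
    (sum-cong-≗ λ j → trans (sym (ℚ.*-assoc (ι z) (ι (k j)) (x j)))
      (cong (_* x j) (sym (ι-* z (k j))))))

neg-isIntegral : ∀ {m} {φ : Vector ℚ m → ℚ} → IsIntegral φ → IsIntegral (λ x → - φ x)
neg-isIntegral {φ = φ} h with *-isIntegral (ℤ.- 1ℤ) h
... | k , φ≡ = k , λ x → trans
  (solve 1 (λ y → :- y := con (- 1ℚ) :* y) refl (φ x)) (φ≡ x)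

minus-isIntegral : ∀ {m} {φ ψ : Vector ℚ m → ℚ} →
  IsIntegral φ → IsIntegral ψ → IsIntegral (λ x → φ x - ψ x)
minus-isIntegral φ ψ = +-isIntegral φ (neg-isIntegral ψ)

sum-isIntegral : ∀ {m l} {φ : Fin l → Vector ℚ m → ℚ} →
  (∀ j → IsIntegral (φ j)) → IsIntegral (λ x → sum (λ j → φ j x))
sum-isIntegral {l = zero}  φ = zero-isIntegral
sum-isIntegral {l = suc l} φ = +-isIntegral (φ zero) (sum-isIntegral (φ ∘ suc))

-- Gaussian elimination: the pivot 1 + 2k₀₀ is odd, and its Schur complement,
-- multiplied by the pivot to keep it integral, is again the identity modulo 2.
1+φ+φ-surjective : ∀ {m} (φ : Fin m → Vector ℚ m → ℚ) → (∀ i → IsIntegral (φ i)) →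
  ∀ (b : Vector ℚ m) → ∃ λ x → ∀ i → x i + (φ i x + φ i x) ≡ b i
1+φ+φ-surjective {zero}  φ _ b = b , λ ()
1+φ+φ-surjective {suc m} φ int b = x , sol
  where
  k : Fin (suc m) → Vector ℤ (suc m)
  k i = proj₁ (int i)

  φ′ : Fin (suc m) → Vector ℚ m → ℚ
  φ′ i y = sum λ j → ι (k i (suc j)) * y j

  φ′-isIntegral : ∀ i → IsIntegral (φ′ i)
  φ′-isIntegral i = tail (k i) , λ _ → refl

  k₀₀ = k zero zero
  a   = 1ℚ + (ι k₀₀ + ι k₀₀)
  q   = proj₁ (1+z+z-invertible k₀₀)

  qa≡1 : q * a ≡ 1ℚ
  qa≡1 = proj₂ (1+z+z-invertible k₀₀)

  e : Fin m → ℚ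
  e i = ι (k (suc i) zero)

  b₀ = b zero

  -- Row `suc i` times the pivot `a`, minus `2 e i` times row `zero`, eliminates `x₀` and reads
  -- `y i + 2 ψ i y ≡ a b (suc i) - 2 e i b₀`.
  ψ : Fin m → Vector ℚ m → ℚ
  ψ i y = (ι k₀₀ * y i + (φ′ (suc i) y + (ι k₀₀ * φ′ (suc i) y + ι k₀₀ * φ′ (suc i) y)))
    - (e i * φ′ zero y + e i * φ′ zero y)

  ψ-isIntegral : ∀ i → IsIntegral (ψ i)
  ψ-isIntegral i = minus-isIntegral
    (+-isIntegral (*-isIntegral k₀₀ (lookup-isIntegral i))
      (+-isIntegral (φ′-isIntegral (suc i)) (+-isIntegral kφ kφ)))
    (+-isIntegral eφ eφ)
    where
    kφ = *-isIntegral k₀₀ (φ′-isIntegral (suc i))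
    eφ = *-isIntegral (k (suc i) zero) (φ′-isIntegral zero)

  rec = 1+φ+φ-surjective ψ ψ-isIntegral λ i → a * b (suc i) - (e i * b₀ + e i * b₀)

  y = proj₁ rec
  p = φ′ zero y

  x₀ : ℚ
  x₀ = q * (b₀ - (p + p))

  x : Vector ℚ (suc m)
  x = x₀ ∷ᵛ y

  φ≡ : ∀ i → φ i x ≡ ι (k i zero) * x₀ + φ′ i y
  φ≡ i = proj₂ (int i) x

  sol : ∀ i → x i + (φ i x + φ i x) ≡ b i
  sol zero = begin
    x₀ + (φ zero x + φ zero x)
      ≡⟨ cong (x₀ +_) (cong₂ _+_ (φ≡ zero) (φ≡ zero)) ⟩
    x₀ + ((ι k₀₀ * x₀ + p) + (ι k₀₀ * x₀ + p))
      ≡⟨ solve 4 (λ K q b p → let x = q :* (b :- (p :+ p)) in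
           x :+ ((K :* x :+ p) :+ (K :* x :+ p)) :=
           (q :* (con 1ℚ :+ (K :+ K))) :* (b :- (p :+ p)) :+ (p :+ p))
         refl (ι k₀₀) q b₀ p ⟩
    (q * a) * (b₀ - (p + p)) + (p + p)
      ≡⟨ cong (λ c → c * (b₀ - (p + p)) + (p + p)) qa≡1 ⟩
    1ℚ * (b₀ - (p + p)) + (p + p)
      ≡⟨ solve 2 (λ b p → con 1ℚ :* (b :- (p :+ p)) :+ (p :+ p) := b) refl b₀ p ⟩
    b₀ ∎
  sol (suc i) = begin
    y i + (φ (suc i) x + φ (suc i) x)
      ≡⟨ cong (y i +_) (cong₂ _+_ (φ≡ (suc i)) (φ≡ (suc i))) ⟩
    y i + ((e i * x₀ + s) + (e i * x₀ + s))
      ≡⟨ solve 4 (λ e x y s → y :+ ((e :* x :+ s) :+ (e :* x :+ s)) :=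
           con 1ℚ :* (y :+ (s :+ s)) :+ (e :* x :+ e :* x))
         refl (e i) x₀ (y i) s ⟩
    1ℚ * (y i + (s + s)) + (e i * x₀ + e i * x₀)
      ≡⟨ cong (λ c → c * (y i + (s + s)) + (e i * x₀ + e i * x₀)) qa≡1 ⟨
    (q * a) * (y i + (s + s)) + (e i * x₀ + e i * x₀)
      ≡⟨ solve 7 (λ K q b p e s y →
           let x  = q :* (b :- (p :+ p))
               ψ′ = (K :* y :+ (s :+ (K :* s :+ K :* s))) :- (e :* p :+ e :* p) in
           (q :* (con 1ℚ :+ (K :+ K))) :* (y :+ (s :+ s)) :+ (e :* x :+ e :* x) :=
           q :* ((y :+ (ψ′ :+ ψ′)) :+ (e :* b :+ e :* b)))
         refl (ι k₀₀) q b₀ p (e i) s (y i) ⟩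
    q * ((y i + (ψ i y + ψ i y)) + (e i * b₀ + e i * b₀))
      ≡⟨ cong (λ c → q * (c + (e i * b₀ + e i * b₀))) (proj₂ rec i) ⟩
    q * ((a * b (suc i) - (e i * b₀ + e i * b₀)) + (e i * b₀ + e i * b₀))
      ≡⟨ solve 4 (λ q a b c → q :* ((a :* b :- c) :+ c) := (q :* a) :* b) refl
           q a (b (suc i)) (e i * b₀ + e i * b₀) ⟩
    (q * a) * b (suc i)
      ≡⟨ cong (_* b (suc i)) qa≡1 ⟩
    1ℚ * b (suc i)
      ≡⟨ ℚ.*-identityˡ _ ⟩
    b (suc i) ∎
    where
    s = φ′ (suc i) y

-- Invertibility of rational matrices

infixr 7 _*ᵛ_

_*ᵛ_ : ∀ {m} → Matrix m → Vector ℚ m → Vector ℚ m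
(A *ᵛ x) i = sum λ j → A i j * x j

*ᵛ-cong : ∀ {m} {A B : Matrix m} {x y : Vector ℚ m} → A ≈ᴹ B → x ≗ y → A *ᵛ x ≗ B *ᵛ y
*ᵛ-cong A≈B x≗y i = sum-cong-≗ λ j → cong₂ _*_ (A≈B i j) (x≗y j)

*ᵛ-zero : ∀ {m} (A : Matrix m) → A *ᵛ (λ _ → 0ℚ) ≗ (λ _ → 0ℚ)
*ᵛ-zero {m} A i = trans (sum-cong-≗ λ j → ℚ.*-zeroʳ (A i j)) (sum-replicate-zero m)

*ᵛ-identityˡ : ∀ {m} (x : Vector ℚ m) → 1ᴹ *ᵛ x ≗ x
*ᵛ-identityˡ {suc m} x zero = trans
  (cong₂ _+_ (ℚ.*-identityˡ (x zero))
    (trans (sum-cong-≗ λ j → ℚ.*-zeroˡ (x (suc j))) (sum-replicate-zero m)))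
  (ℚ.+-identityʳ (x zero))
*ᵛ-identityˡ {suc m} x (suc i) = trans
  (cong₂ _+_ (ℚ.*-zeroˡ (x zero)) (*ᵛ-identityˡ (tail x) i))
  (ℚ.+-identityˡ (x (suc i)))

*ᵛ-assoc : ∀ {m} (A B : Matrix m) (x : Vector ℚ m) → (A *ᴹ B) *ᵛ x ≗ A *ᵛ (B *ᵛ x)
*ᵛ-assoc A B x i = begin
  sum (λ k → sum (λ j → A i j * B j k) * x k)
    ≡⟨ sum-cong-≗ (λ k → *-distribʳ-sum (x k) (λ j → A i j * B j k)) ⟩
  sum (λ k → sum (λ j → A i j * B j k * x k))
    ≡⟨ ∑-comm (λ k j → A i j * B j k * x k) ⟩
  sum (λ j → sum (λ k → A i j * B j k * x k))
    ≡⟨ sum-cong-≗ (λ j → trans (sum-cong-≗ (λ k → ℚ.*-assoc (A i j) (B j k) (x k)))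
         (sym (*-distribˡ-sum (A i j) (λ k → B j k * x k)))) ⟩
  sum (λ j → A i j * sum (λ k → B j k * x k)) ∎

infix 9 _ᵀ

_ᵀ : ∀ {m} → Matrix m → Matrix m
(A ᵀ) i j = A j i

1ᴹ-sym : ∀ {m} (i j : Fin m) → 1ᴹ i j ≡ 1ᴹ j i
1ᴹ-sym zero    zero    = refl
1ᴹ-sym zero    (suc j) = refl
1ᴹ-sym (suc i) zero    = refl
1ᴹ-sym (suc i) (suc j) = 1ᴹ-sym i j

kernel⇒singular : ∀ {m} (A : Matrix m) (x : Vector ℚ m) i →
  A *ᵛ x ≗ (λ _ → 0ℚ) → x i ≢ 0ℚ → SingularMatrix A
kernel⇒singular A x i Ax≡0 xᵢ≢0 (B , _ , BA≈1) = xᵢ≢0 (begin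
  x i                   ≡⟨ *ᵛ-identityˡ x i ⟨
  (1ᴹ *ᵛ x) i           ≡⟨ *ᵛ-cong BA≈1 (λ _ → refl) i ⟨
  ((B *ᴹ A) *ᵛ x) i     ≡⟨ *ᵛ-assoc B A x i ⟩
  (B *ᵛ (A *ᵛ x)) i     ≡⟨ *ᵛ-cong {A = B} (λ _ _ → refl) Ax≡0 i ⟩
  (B *ᵛ (λ _ → 0ℚ)) i   ≡⟨ *ᵛ-zero B i ⟩
  0ℚ                    ∎)

-- Preimages of the unit vectors are the columns of a right inverse `B`. Transposing `AB = 1` with
-- `A` symmetric makes `Bᵀ` a left inverse, and a left and a right inverse agree:
-- `B = (BᵀA)B = Bᵀ(AB) = Bᵀ`.
symmetric∧surjective⇒invertible : ∀ {m} (A : Matrix m) → A ᵀ ≈ᴹ A →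
  (∀ b → ∃ λ x → A *ᵛ x ≗ b) → Invertible A
symmetric∧surjective⇒invertible A Aᵀ≈A surj = B , AB≈1 , BA≈1
  where
  B : Matrix _
  B i j = proj₁ (surj ((1ᴹ ᵀ) j)) i

  AB≈1 : A *ᴹ B ≈ᴹ 1ᴹ
  AB≈1 i j = proj₂ (surj ((1ᴹ ᵀ) j)) i

  BᵀA≈1 : B ᵀ *ᴹ A ≈ᴹ 1ᴹ
  BᵀA≈1 i j = begin
    sum (λ k → B k i * A k j)
      ≡⟨ sum-cong-≗ (λ k → trans (ℚ.*-comm (B k i) (A k j)) (cong (_* B k i) (Aᵀ≈A j k))) ⟩
    (A *ᴹ B) j i               ≡⟨ AB≈1 j i ⟩
    1ᴹ j i                     ≡⟨ 1ᴹ-sym j i ⟩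
    1ᴹ i j                     ∎

  B≈Bᵀ : B ≈ᴹ B ᵀ
  B≈Bᵀ i j = begin
    B i j                                ≡⟨ *ᵛ-identityˡ ((B ᵀ) j) i ⟨
    (1ᴹ *ᵛ (B ᵀ) j) i                    ≡⟨ *ᵛ-cong BᵀA≈1 (λ _ → refl) i ⟨
    ((B ᵀ *ᴹ A) *ᵛ (B ᵀ) j) i            ≡⟨ *ᵛ-assoc (B ᵀ) A ((B ᵀ) j) i ⟩
    (B ᵀ *ᵛ (A *ᵛ (B ᵀ) j)) i            ≡⟨ sum-cong-≗ (λ l → trans
                                              (cong (B l i *_) (trans (AB≈1 l j) (1ᴹ-sym l j)))
                                              (ℚ.*-comm (B l i) (1ᴹ j l))) ⟩
    (1ᴹ *ᵛ (B ᵀ) i) j                    ≡⟨ *ᵛ-identityˡ ((B ᵀ) i) j ⟩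
    B j i                                ∎

  BA≈1 : B *ᴹ A ≈ᴹ 1ᴹ
  BA≈1 i j = trans (sum-cong-≗ λ k → cong (_* A k j) (B≈Bᵀ i k)) (BᵀA≈1 i j)

-- Sums over intervals and periodic sequences

-- Summands live on all of ℕ, so that shifts are plain additions, while the sum itself remains one
-- over `Fin`.
∑< : ℕ → (ℕ → ℚ) → ℚ
∑< n f = sum {n} (f ∘ toℕ)

∑<-cong : ∀ n {f g : ℕ → ℚ} → (∀ k → f k ≡ g k) → ∑< n f ≡ ∑< n g
∑<-cong n f≗g = sum-cong-≗ {n} (f≗g ∘ toℕ)

∑<-cong-< : ∀ n {f g : ℕ → ℚ} → (∀ k → k < n → f k ≡ g k) → ∑< n f ≡ ∑< n g
∑<-cong-< n f≗g = sum-cong-≗ {n} λ i → f≗g (toℕ i) (Fin.toℕ<n i)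

∑<-zero : ∀ n {f : ℕ → ℚ} → (∀ k → k < n → f k ≡ 0ℚ) → ∑< n f ≡ 0ℚ
∑<-zero n f≗0 = trans (∑<-cong-< n f≗0) (sum-replicate-zero n)

∑<-distrib-+ : ∀ n (f g : ℕ → ℚ) → ∑< n (λ k → f k + g k) ≡ ∑< n f + ∑< n g
∑<-distrib-+ n f g = ∑-distrib-+ {n} (f ∘ toℕ) (g ∘ toℕ)

∑<-distrib-minus : ∀ n (f g : ℕ → ℚ) → ∑< n (λ k → f k - g k) ≡ ∑< n f - ∑< n g
∑<-distrib-minus zero    f g = refl
∑<-distrib-minus (suc n) f g = trans
  (cong (f 0 - g 0 +_) (∑<-distrib-minus n (f ∘ suc) (g ∘ suc)))
  (solve 4 (λ a b c d → (a :- b) :+ (c :- d) := (a :+ c) :- (b :+ d)) refl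
    (f 0) (g 0) (∑< n (f ∘ suc)) (∑< n (g ∘ suc)))

∑<-comm : ∀ m n (f : ℕ → ℕ → ℚ) →
  ∑< m (λ i → ∑< n (f i)) ≡ ∑< n (λ j → ∑< m (λ i → f i j))
∑<-comm m n f = ∑-comm {m} {n} λ i j → f (toℕ i) (toℕ j)

∑<-+ : ∀ m n (f : ℕ → ℚ) → ∑< (m ℕ.+ n) f ≡ ∑< m f + ∑< n (λ k → f (m ℕ.+ k))
∑<-+ zero    n f = sym (ℚ.+-identityˡ (∑< n f))
∑<-+ (suc m) n f = trans (cong (f 0 +_) (∑<-+ m n (f ∘ suc)))
  (sym (ℚ.+-assoc (f 0) (∑< m (f ∘ suc)) (∑< n (λ k → f (suc m ℕ.+ k)))))

∑<-* : ∀ m n (f : ℕ → ℚ) → ∑< (m ℕ.* n) f ≡ ∑< m λ j → ∑< n λ k → f (j ℕ.* n ℕ.+ k)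
∑<-* zero    n f = refl
∑<-* (suc m) n f = trans (∑<-+ n (m ℕ.* n) f)
  (cong (∑< n f +_) (trans (∑<-* m n (λ l → f (n ℕ.+ l)))
    (∑<-cong m λ j → ∑<-cong n λ k → cong f (sym (ℕ.+-assoc n (j ℕ.* n) k)))))

∑<-telescope : ∀ (g : ℕ → ℚ) l c → ∑< l (λ k → g (k ℕ.+ c) - g (suc (k ℕ.+ c))) ≡ g c - g (l ℕ.+ c)
∑<-telescope g zero    c = sym (ℚ.+-inverseʳ (g c))
∑<-telescope g (suc l) c = begin
  (g c - g (suc c)) + ∑< l (λ k → g (suc k ℕ.+ c) - g (suc (suc k ℕ.+ c)))
    ≡⟨ cong ((g c - g (suc c)) +_) (∑<-telescope (g ∘ suc) l c) ⟩
  (g c - g (suc c)) + (g (suc c) - g (suc l ℕ.+ c))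
    ≡⟨ solve 3 (λ a b c → (a :- b) :+ (b :- c) := a :- c) refl (g c) (g (suc c)) (g (suc l ℕ.+ c)) ⟩
  g c - g (suc l ℕ.+ c) ∎

Periodic : ℕ → (ℕ → ℚ) → Set
Periodic p f = ∀ i → f (p ℕ.+ i) ≡ f i

Periodic-* : ∀ {p f} → Periodic p f → ∀ m → Periodic (m ℕ.* p) f
Periodic-* per zero    i = refl
Periodic-* {p} {f} per (suc m) i = trans (cong f (ℕ.+-assoc p (m ℕ.* p) i))
  (trans (per (m ℕ.* p ℕ.+ i)) (Periodic-* per m i))

Periodic-shift : ∀ {p f} → Periodic p f → ∀ c → Periodic p (λ i → f (c ℕ.+ i))
Periodic-shift {p} {f} per c i =
  trans (cong f (lemma c p i)) (per (c ℕ.+ i))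
  where
  lemma : ∀ c p i → c ℕ.+ (p ℕ.+ i) ≡ p ℕ.+ (c ℕ.+ i)
  lemma = ℕ.solve-∀

-- Moving the window one step drops `g 0` and appends `g p`, which is the same value.
∑<-periodic : ∀ {p f} → Periodic p f → ∀ i → ∑< p (λ k → f (k ℕ.+ i)) ≡ ∑< p f
∑<-periodic {p} {f} per zero    = ∑<-cong p λ k → cong f (ℕ.+-identityʳ k)
∑<-periodic {p} {f} per (suc i) = begin
  ∑< p (λ k → f (k ℕ.+ suc i))  ≡⟨ ∑<-cong p (λ k → cong f (ℕ.+-suc k i)) ⟩
  ∑< p (g ∘ suc)                ≡⟨ ∙-cancelˡ ℚ.+-0-group (g 0) _ _ rotate ⟩
  ∑< p g                        ≡⟨ ∑<-periodic per i ⟩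
  ∑< p f                        ∎
  where
  g : ℕ → ℚ
  g k = f (k ℕ.+ i)

  rotate : g 0 + ∑< p (g ∘ suc) ≡ g 0 + ∑< p g
  rotate = begin
    ∑< (suc p) g                        ≡⟨ cong (λ l → ∑< l g) (ℕ.+-comm 1 p) ⟩
    ∑< (p ℕ.+ 1) g                      ≡⟨ ∑<-+ p 1 g ⟩
    ∑< p g + (g (p ℕ.+ 0) + 0ℚ)         ≡⟨ cong (λ x → ∑< p g + (x + 0ℚ)) g[p]≡g[0] ⟩
    ∑< p g + (g 0 + 0ℚ)                 ≡⟨ cong (∑< p g +_) (ℚ.+-identityʳ (g 0)) ⟩
    ∑< p g + g 0                        ≡⟨ ℚ.+-comm (∑< p g) (g 0) ⟩
    g 0 + ∑< p g                        ∎
    where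
    g[p]≡g[0] : g (p ℕ.+ 0) ≡ g 0
    g[p]≡g[0] = trans (cong f (ℕ.+-assoc p 0 i)) (per i)

∑<-periods : ∀ {p f} → Periodic p f → ∀ m → ∑< (m ℕ.* p) f ≡ ∑< m λ _ → ∑< p f
∑<-periods {p} {f} per m = trans (∑<-* m p f)
  (∑<-cong m λ j → ∑<-cong p λ k → Periodic-* per j k)

-- The matrix of C(2n,r) acts on 2n-periodic sequences as this operator when r′ + r = 2n.
circulant : (n r r′ : ℕ) → (ℕ → ℚ) → ℕ → ℚ
circulant n r r′ h i = (∑< (2 ℕ.* r ℕ.+ 1) (λ k → h (k ℕ.+ (r′ ℕ.+ i))) - h i) + h (n ℕ.+ i)

-- Inverting the circulant operator modulo 2

module Operators (n r s t : ℕ) where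

  -- This is `Tⁿ − 1`, the difference between the circulant operator and the centred window sum.
  D : (ℕ → ℚ) → ℕ → ℚ
  D h i = h (n ℕ.+ i) - h i

  jump : ℕ → ℕ → ℕ
  jump i j = r ℕ.+ (j ℕ.* (2 ℕ.* r ℕ.+ 1) ℕ.+ i)

  -- In terms of the shift this is `Tʳ(1 + Tᴸ + T²ᴸ + ⋯)` with `s` terms and `L = 2r + 1`. Its
  -- product with the centred window sum is the unbroken sum of the first `sL` powers of `T`.
  U : (ℕ → ℚ) → ℕ → ℚ
  U h i = ∑< s λ j → h (jump i j)

  N : (ℕ → ℚ) → ℚ
  N h = ∑< t λ _ → ∑< (2 ℕ.* n) h

  -- If s(2r + 1) = 1 + 4nt, the circulant operator A satisfies AU = 1 + 2N + DU.
  -- Together with D² = −2D and ND = 0 this gives AU(1 + DU) = 1 + 2C.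
  C : (ℕ → ℚ) → ℕ → ℚ
  C h i = (N h + D (U h) i) - D (U (U h)) i

  _⊕_ : (ℕ → ℚ) → (ℕ → ℚ) → ℕ → ℚ
  (g ⊕ h) i = g i + h i

  U-periodic : ∀ {p h} → Periodic p h → Periodic p (U h)
  U-periodic {p} {h} per i = ∑<-cong s λ j →
    trans (cong h (lemma r (j ℕ.* (2 ℕ.* r ℕ.+ 1)) p i)) (per _)
    where
    lemma : ∀ r a p i → r ℕ.+ (a ℕ.+ (p ℕ.+ i)) ≡ p ℕ.+ (r ℕ.+ (a ℕ.+ i))
    lemma = ℕ.solve-∀

  D-periodic : ∀ {p h} → Periodic p h → Periodic p (D h)
  D-periodic per i = cong₂ _-_ (Periodic-shift per n i) (per i)

  U-⊕ : ∀ g h i → U (g ⊕ h) i ≡ U g i + U h i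
  U-⊕ g h i = ∑<-distrib-+ s (g ∘ jump i) (h ∘ jump i)

  U-D : ∀ h i → U (D h) i ≡ D (U h) i
  U-D h i = trans (∑<-distrib-minus s (λ j → h (n ℕ.+ jump i j)) (h ∘ jump i)) (cong (_- U h i)
    (∑<-cong s λ j → cong h (lemma r (j ℕ.* (2 ℕ.* r ℕ.+ 1)) n i)))
    where
    lemma : ∀ r a n i → n ℕ.+ (r ℕ.+ (a ℕ.+ i)) ≡ r ℕ.+ (a ℕ.+ (n ℕ.+ i))
    lemma = ℕ.solve-∀

  -- `(Tⁿ − 1)² = T²ⁿ − 2Tⁿ + 1`, and `T²ⁿ = 1` on these sequences. This makes `D` nilpotent modulo
  -- 2.
  D-D : ∀ {h} → Periodic (2 ℕ.* n) h → ∀ i → D (D h) i ≡ - (D h i + D h i)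
  D-D {h} per i = trans
    (cong (λ x → (x - h (n ℕ.+ i)) - (h (n ℕ.+ i) - h i)) (trans (cong h (lemma n i)) (per i)))
    (solve 2 (λ x y → (x :- y) :- (y :- x) := :- ((y :- x) :+ (y :- x))) refl (h i) (h (n ℕ.+ i)))
    where
    lemma : ∀ n i → n ℕ.+ (n ℕ.+ i) ≡ 2 ℕ.* n ℕ.+ i
    lemma = ℕ.solve-∀

  -- The sum over a full period does not change under a shift, so `N` vanishes on the image of `D`.
  N-⊕-D : ∀ g {h} → Periodic (2 ℕ.* n) h → N (g ⊕ D h) ≡ N g
  N-⊕-D g {h} per = ∑<-cong t λ _ → begin
    ∑< 2n (g ⊕ D h)
      ≡⟨ ∑<-distrib-+ 2n g (D h) ⟩
    ∑< 2n g + ∑< 2n (D h)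
      ≡⟨ cong (∑< 2n g +_) (∑<-distrib-minus 2n (λ k → h (n ℕ.+ k)) h) ⟩
    ∑< 2n g + (∑< 2n (λ k → h (n ℕ.+ k)) - ∑< 2n h)
      ≡⟨ cong (λ x → ∑< 2n g + (x - ∑< 2n h)) shift ⟩
    ∑< 2n g + (∑< 2n h - ∑< 2n h)
      ≡⟨ solve 2 (λ a b → a :+ (b :- b) := a) refl (∑< 2n g) (∑< 2n h) ⟩
    ∑< 2n g ∎
    where
    2n = 2 ℕ.* n

    shift : ∑< 2n (λ k → h (n ℕ.+ k)) ≡ ∑< 2n h
    shift = trans (∑<-cong 2n λ k → cong h (ℕ.+-comm n k)) (∑<-periodic per n)

  private
    IsIntegralSequence : ∀ {m} → (Vector ℚ m → ℕ → ℚ) → Set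
    IsIntegralSequence h = ∀ i → IsIntegral λ x → h x i

  U-isIntegral : ∀ {m} {h : Vector ℚ m → ℕ → ℚ} → IsIntegralSequence h → IsIntegralSequence (U ∘ h)
  U-isIntegral h i = sum-isIntegral {l = s} λ j → h (jump i (toℕ j))

  D-isIntegral : ∀ {m} {h : Vector ℚ m → ℕ → ℚ} → IsIntegralSequence h → IsIntegralSequence (D ∘ h)
  D-isIntegral h i = minus-isIntegral (h (n ℕ.+ i)) (h i)

  C-isIntegral : ∀ {m} {h : Vector ℚ m → ℕ → ℚ} → IsIntegralSequence h → IsIntegralSequence (C ∘ h)
  C-isIntegral h i = minus-isIntegral
    (+-isIntegral (sum-isIntegral {l = t} λ _ → sum-isIntegral {l = 2 ℕ.* n} (h ∘ toℕ))
      (D-isIntegral (U-isIntegral h) i))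
    (D-isIntegral (U-isIntegral (U-isIntegral h)) i)

  module _ {r′} (r′+r≡2n : r′ ℕ.+ r ≡ 2 ℕ.* n)
    (bézout : 1 ℕ.+ t ℕ.* (2 ℕ.* (2 ℕ.* n)) ≡ s ℕ.* (2 ℕ.* r ℕ.+ 1)) where

    private
      L  = 2 ℕ.* r ℕ.+ 1
      2n = 2 ℕ.* n

    -- Every index below `sL` is `jL + k` for exactly one `j < s` and `k < L`, so the double sum
    -- runs over `sL = 1 + 4nt` consecutive terms: `h i` and then `2t` full periods.
    window-U : ∀ {h} → Periodic 2n h → ∀ i →
      ∑< L (λ k → U h (k ℕ.+ (r′ ℕ.+ i))) ≡ h i + (N h + N h)
    window-U {h} per i = begin
      ∑< L (λ k → U h (k ℕ.+ (r′ ℕ.+ i)))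
        ≡⟨ ∑<-comm L s (λ k → h ∘ jump (k ℕ.+ (r′ ℕ.+ i))) ⟩
      ∑< s (λ j → ∑< L λ k → h (r ℕ.+ (j ℕ.* L ℕ.+ (k ℕ.+ (r′ ℕ.+ i)))))
        ≡⟨ ∑<-cong s (λ j → ∑<-cong L λ k → unshift (j ℕ.* L) k) ⟩
      ∑< s (λ j → ∑< L λ k → h ((j ℕ.* L ℕ.+ k) ℕ.+ i))
        ≡⟨ ∑<-* s L (λ l → h (l ℕ.+ i)) ⟨
      ∑< (s ℕ.* L) (λ l → h (l ℕ.+ i))
        ≡⟨ cong (λ m → ∑< m (λ l → h (l ℕ.+ i))) bézout ⟨
      h i + ∑< (t ℕ.* (2 ℕ.* 2n)) (λ l → h (suc l ℕ.+ i))
        ≡⟨ cong (h i +_) (∑<-periods (Periodic-* per′ 2) t) ⟩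
      h i + ∑< t (λ _ → ∑< (2 ℕ.* 2n) (λ l → h (suc l ℕ.+ i)))
        ≡⟨ cong (h i +_) (∑<-cong t λ _ → twice) ⟩
      h i + ∑< t (λ _ → ∑< 2n h + ∑< 2n h)
        ≡⟨ cong (h i +_) (∑<-distrib-+ t (λ _ → ∑< 2n h) (λ _ → ∑< 2n h)) ⟩
      h i + (N h + N h) ∎
      where
      -- The shift by `r′` in the window stands for `T⁻ʳ` and cancels the `Tʳ` in `U`, since
      -- `r′ + r` is a period.
      unshift : ∀ a k → h (r ℕ.+ (a ℕ.+ (k ℕ.+ (r′ ℕ.+ i)))) ≡ h ((a ℕ.+ k) ℕ.+ i)
      unshift a k = trans
        (cong h (trans (lemma r r′ a k i) (cong (ℕ._+ ((a ℕ.+ k) ℕ.+ i)) r′+r≡2n)))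
        (per _)
        where
        lemma : ∀ r r′ a k i → r ℕ.+ (a ℕ.+ (k ℕ.+ (r′ ℕ.+ i))) ≡ (r′ ℕ.+ r) ℕ.+ ((a ℕ.+ k) ℕ.+ i)
        lemma = ℕ.solve-∀

      per′ : Periodic 2n (λ l → h (suc l ℕ.+ i))
      per′ l = trans (cong h (lemma n l i)) (per (suc l ℕ.+ i))
        where
        lemma : ∀ n l i → suc (2 ℕ.* n ℕ.+ l) ℕ.+ i ≡ 2 ℕ.* n ℕ.+ (suc l ℕ.+ i)
        lemma = ℕ.solve-∀

      -- Inverting `L` modulo `4n` instead of `2n` pays off here: the terms left over form an even
      -- number of periods and vanish modulo 2.
      twice : ∑< (2 ℕ.* 2n) (λ l → h (suc l ℕ.+ i)) ≡ ∑< 2n h + ∑< 2n h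
      twice = begin
        ∑< (2 ℕ.* 2n) (λ l → h (suc l ℕ.+ i))
          ≡⟨ ∑<-periods per′ 2 ⟩
        ∑< 2n (λ l → h (suc l ℕ.+ i)) + (∑< 2n (λ l → h (suc l ℕ.+ i)) + 0ℚ)
          ≡⟨ cong (λ x → x + (x + 0ℚ)) (trans
               (∑<-cong 2n λ l → cong h (sym (ℕ.+-suc l i)))
               (∑<-periodic per (suc i))) ⟩
        ∑< 2n h + (∑< 2n h + 0ℚ)
          ≡⟨ cong (∑< 2n h +_) (ℚ.+-identityʳ _) ⟩
        ∑< 2n h + ∑< 2n h ∎

    -- Applying `AU = 1 + 2N + DU` to `g = (1 + DU)h` gives `(1 + DU)²h + 2Nh`. As `D` and `U`
    -- commute, the square is `1 + 2DU + D²U²`, and `D² = −2D` makes its last term even too.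
    circulant-U : ∀ {h} → Periodic 2n h → ∀ i →
      circulant n r r′ (U (h ⊕ D (U h))) i ≡ h i + (C h i + C h i)
    circulant-U {h} per i = begin
      (∑< L (λ k → U g (k ℕ.+ (r′ ℕ.+ i))) - U g i) + U g (n ℕ.+ i)
        ≡⟨ cong (λ x → (x - U g i) + U g (n ℕ.+ i)) (window-U g-periodic i) ⟩
      ((g i + (N g + N g)) - U g i) + U g (n ℕ.+ i)
        ≡⟨ cong (λ x → ((g i + (x + x)) - U g i) + U g (n ℕ.+ i)) (N-⊕-D h (U-periodic per)) ⟩
      ((g i + (N h + N h)) - U g i) + U g (n ℕ.+ i)
        ≡⟨ cong₂ (λ x y → ((g i + (N h + N h)) - x) + y) (U-g i) (U-g (n ℕ.+ i)) ⟩
      (((h i + (u₁ - u₀)) + (N h + N h)) - (u₀ + d₀)) + (u₁ + d₁)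
        ≡⟨ solve 6 (λ h N u₀ u₁ d₀ d₁ →
             (((h :+ (u₁ :- u₀)) :+ (N :+ N)) :- (u₀ :+ d₀)) :+ (u₁ :+ d₁) :=
             ((h :+ (N :+ N)) :+ ((u₁ :- u₀) :+ (u₁ :- u₀))) :+ (d₁ :- d₀))
           refl (h i) (N h) u₀ u₁ d₀ d₁ ⟩
      ((h i + (N h + N h)) + (D (U h) i + D (U h) i)) + D (D (U (U h))) i
        ≡⟨ cong (((h i + (N h + N h)) + (D (U h) i + D (U h) i)) +_) (D-D (U-periodic (U-periodic per)) i) ⟩
      ((h i + (N h + N h)) + (D (U h) i + D (U h) i)) - (D (U (U h)) i + D (U (U h)) i)
        ≡⟨ solve 4 (λ h N d e →
             ((h :+ (N :+ N)) :+ (d :+ d)) :- (e :+ e) :=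
             h :+ (((N :+ d) :- e) :+ ((N :+ d) :- e)))
           refl (h i) (N h) (D (U h) i) (D (U (U h)) i) ⟩
      h i + (C h i + C h i) ∎
      where
      g  = h ⊕ D (U h)
      u₀ = U h i
      u₁ = U h (n ℕ.+ i)
      d₀ = D (U (U h)) i
      d₁ = D (U (U h)) (n ℕ.+ i)

      g-periodic : Periodic 2n g
      g-periodic k = cong₂ _+_ (per k) (D-periodic (U-periodic per) k)

      U-g : ∀ k → U g k ≡ U h k + D (U (U h)) k
      U-g k = trans (U-⊕ h (D (U h)) k) (cong (U h k +_) (U-D (U h) k))

-- Divisibility

module DivisibilityIndicator (d : ℕ) where

  indicator : ℕ → ℚ
  indicator j = if does (d ∣? j) then 1ℚ else 0ℚ

  indicator-∣ : ∀ {j} → d ∣ j → indicator j ≡ 1ℚ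
  indicator-∣ {j} d∣j = cong (λ b → if b then 1ℚ else 0ℚ) (dec-true (d ∣? j) d∣j)

  indicator-∤ : ∀ {j} → ¬ d ∣ j → indicator j ≡ 0ℚ
  indicator-∤ {j} d∤j = cong (λ b → if b then 1ℚ else 0ℚ) (dec-false (d ∣? j) d∤j)

  indicator-periodic : ∀ {p} → d ∣ p → Periodic p indicator
  indicator-periodic d∣p i with d ∣? i
  ... | yes d∣i = indicator-∣ (∣m∣n⇒∣m+n d∣p d∣i)
  ... | no  d∤i = indicator-∤ λ d∣p+i → d∤i (∣m+n∣m⇒∣n d∣p+i d∣p)

2∤2r+1 : ∀ r → ¬ 2 ∣ 2 ℕ.* r ℕ.+ 1
2∤2r+1 r 2∣2r+1 with ∣1⇒≡1 (∣m+n∣m⇒∣n 2∣2r+1 (m∣m*n r))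
... | ()

-- The gcd divides the odd number `2r + 1`, so being less than 3 it is 1. A common divisor of `4n`
-- and `2r + 1` is odd; Euclid's lemma, applied twice, removes the factors 2 and leaves a divisor of
-- `n`.
coprime-4n : ∀ n r → ¬ 3 ≤ gcd n (2 ℕ.* r ℕ.+ 1) → Coprime (2 ℕ.* (2 ℕ.* n)) (2 ℕ.* r ℕ.+ 1)
coprime-4n n r gcd≱3 {d} (d∣4n , d∣L) = ∣1⇒≡1 (subst (d ∣_) gcd≡1 (gcd-greatest d∣n d∣L))
  where
  gcd≡1 : gcd n (2 ℕ.* r ℕ.+ 1) ≡ 1
  gcd≡1 with gcd n (2 ℕ.* r ℕ.+ 1) in eq
  ... | 0 = contradiction (trans (ℕ.+-comm 1 (2 ℕ.* r)) (gcd[m,n]≡0⇒n≡0 n eq)) λ ()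
  ... | 1 = refl
  ... | 2 = contradiction (subst (_∣ 2 ℕ.* r ℕ.+ 1) eq (gcd[m,n]∣n n (2 ℕ.* r ℕ.+ 1))) (2∤2r+1 r)
  ... | suc (suc (suc g)) = contradiction (s≤s (s≤s (s≤s z≤n))) gcd≱3

  d-odd : Coprime d 2
  d-odd (e∣d , e∣2) = ∣1⇒≡1 (∣m+n∣m⇒∣n (∣-trans e∣d d∣L) (∣m⇒∣m*n r e∣2))

  d∣n : d ∣ n
  d∣n = coprime-divisor d-odd (coprime-divisor d-odd d∣4n)

-- If y(2r+1) ≡ −1 (mod m), an inverse is y²(2r+1) ≡ −y (mod m); the multiple of m added
-- to it makes the quotient t a semiring expression.
odd-inverse : ∀ {m} r → Coprime m (2 ℕ.* r ℕ.+ 1) →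
  ∃₂ λ s t → 1 ℕ.+ t ℕ.* m ≡ s ℕ.* (2 ℕ.* r ℕ.+ 1)
odd-inverse {m} r coprime with coprime-Bézout coprime
... | Bézout.-+ x y eq = y , x , eq
... | Bézout.+- x y eq = y ℕ.* u ℕ.+ 2 ℕ.* (x ℕ.* m) , x ℕ.* (x ℕ.* m ℕ.+ 4 ℕ.* r) , (begin
  1 ℕ.+ x ℕ.* (x ℕ.* m ℕ.+ 4 ℕ.* r) ℕ.* m
    ≡⟨ regroup x m r ⟩
  1 ℕ.+ (x ℕ.* m) ℕ.* (x ℕ.* m ℕ.+ 4 ℕ.* r)
    ≡⟨ cong (λ w → 1 ℕ.+ w ℕ.* (w ℕ.+ 4 ℕ.* r)) eq ⟨
  1 ℕ.+ (1 ℕ.+ u) ℕ.* (1 ℕ.+ u ℕ.+ 4 ℕ.* r)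
    ≡⟨ expand y r ⟩
  (y ℕ.* u ℕ.+ 2 ℕ.* (1 ℕ.+ u)) ℕ.* (2 ℕ.* r ℕ.+ 1)
    ≡⟨ cong (λ w → (y ℕ.* u ℕ.+ 2 ℕ.* w) ℕ.* (2 ℕ.* r ℕ.+ 1)) eq ⟩
  (y ℕ.* u ℕ.+ 2 ℕ.* (x ℕ.* m)) ℕ.* (2 ℕ.* r ℕ.+ 1) ∎)
  where
  u = y ℕ.* (2 ℕ.* r ℕ.+ 1)

  regroup : ∀ x m r → 1 ℕ.+ x ℕ.* (x ℕ.* m ℕ.+ 4 ℕ.* r) ℕ.* m ≡ 1 ℕ.+ (x ℕ.* m) ℕ.* (x ℕ.* m ℕ.+ 4 ℕ.* r)
  regroup = ℕ.solve-∀

  expand : ∀ y r → 1 ℕ.+ (1 ℕ.+ y ℕ.* (2 ℕ.* r ℕ.+ 1)) ℕ.* (1 ℕ.+ y ℕ.* (2 ℕ.* r ℕ.+ 1) ℕ.+ 4 ℕ.* r)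
    ≡ (y ℕ.* (y ℕ.* (2 ℕ.* r ℕ.+ 1)) ℕ.+ 2 ℕ.* (1 ℕ.+ y ℕ.* (2 ℕ.* r ℕ.+ 1))) ℕ.* (2 ℕ.* r ℕ.+ 1)
  expand = ℕ.solve-∀

-- Walks in the cycle

adjacencyMatrix-sym : ∀ {m} (G : Graph m) → adjacencyMatrix G ᵀ ≈ᴹ adjacencyMatrix G
adjacencyMatrix-sym G x y with adj? G x y | adj? G y x
... | yes _  | yes _  = refl
... | no _   | no _   = refl
... | yes xy | no ¬yx = contradiction (adj-sym G xy) ¬yx
... | no ¬xy | yes yx = contradiction (adj-sym G yx) ¬xy

-- Either no shorter walk exists and `k` is the distance, or the argument repeats with a shorter
-- one. The bound `r` drops at each round and serves as the recursion measure.
walk⇒distanceAtMost : ∀ {m} (G : Graph m) r {k x y} → k ≤ r → Walk G k x y → DistanceAtMost G r x y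
walk⇒distanceAtMost G r {k} {x} {y} k≤r w with ℕ.anyUpTo? (λ l → walk? G l x y) k
... | no  min = k , k≤r , w , λ l<k v → min (_ , l<k , v)
walk⇒distanceAtMost G (suc r) k≤r w | yes (l , l<k , v)
  with walk⇒distanceAtMost G r (ℕ.s≤s⁻¹ (ℕ.≤-trans l<k k≤r)) v
... | d , d≤r , p = d , ℕ.m≤n⇒m≤1+n d≤r , p
walk⇒distanceAtMost G zero z≤n w | yes (l , () , v)

module Residues (m : ℕ) .{{_ : NonZero m}} where

  π : ℕ → Fin m
  π k = k ℕ.mod m

  toℕ-π : ∀ k → toℕ (π k) ≡ k ℕ.% m
  toℕ-π k = Fin.toℕ-fromℕ< (ℕ.m%n<n k m)

  toℕ-π-< : ∀ {k} → k < m → toℕ (π k) ≡ k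
  toℕ-π-< {k} k<m = trans (toℕ-π k) (ℕ.m<n⇒m%n≡m k<m)

  π-toℕ : ∀ x → π (toℕ x) ≡ x
  π-toℕ x = Fin.toℕ-injective (toℕ-π-< (Fin.toℕ<n x))

  π-cong-% : ∀ {k l} → k ℕ.% m ≡ l ℕ.% m → π k ≡ π l
  π-cong-% {k} {l} eq = Fin.toℕ-injective (trans (toℕ-π k) (trans eq (sym (toℕ-π l))))

  π-+m : ∀ k → π (m ℕ.+ k) ≡ π k
  π-+m k = π-cong-% (trans (cong (ℕ._% m) (ℕ.+-comm m k)) (ℕ.[m+n]%n≡m%n k m))

  π-+-toℕ-π : ∀ d a → π (d ℕ.+ toℕ (π a)) ≡ π (d ℕ.+ a)
  π-+-toℕ-π d a = π-cong-% (begin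
    (d ℕ.+ toℕ (π a)) ℕ.% m             ≡⟨ cong (λ z → (d ℕ.+ z) ℕ.% m) (toℕ-π a) ⟩
    (d ℕ.+ a ℕ.% m) ℕ.% m               ≡⟨ ℕ.%-distribˡ-+ d (a ℕ.% m) m ⟩
    (d ℕ.% m ℕ.+ a ℕ.% m ℕ.% m) ℕ.% m   ≡⟨ cong (λ z → (d ℕ.% m ℕ.+ z) ℕ.% m) (ℕ.m%n%n≡m%n a m) ⟩
    (d ℕ.% m ℕ.+ a ℕ.% m) ℕ.% m         ≡⟨ ℕ.%-distribˡ-+ d a m ⟨
    (d ℕ.+ a) ℕ.% m                     ∎)

  π-injective : ∀ a {d e} → d < m → e < m → π (d ℕ.+ a) ≡ π (e ℕ.+ a) → d ≡ e
  π-injective a {d} {e} d<m e<m eq = begin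
    d            ≡⟨ toℕ-π-< d<m ⟨
    toℕ (π d)    ≡⟨ cong toℕ πd≡πe ⟩
    toℕ (π e)    ≡⟨ toℕ-π-< e<m ⟩
    e            ∎
    where
    -- Adding `a(m − 1)` to `d + a` gives `d + am`; modulo `m` this subtracts `a` without
    -- truncation.
    undo : ∀ d → π d ≡ π (a ℕ.* ℕ.pred m ℕ.+ (d ℕ.+ a))
    undo d = sym (trans
      (cong π (trans (lemma a (ℕ.pred m) d) (cong (λ z → d ℕ.+ a ℕ.* z) (ℕ.suc-pred m))))
      (π-cong-% (ℕ.[m+kn]%n≡m%n d a m)))
      where
      lemma : ∀ a p d → a ℕ.* p ℕ.+ (d ℕ.+ a) ≡ d ℕ.+ a ℕ.* suc p
      lemma = ℕ.solve-∀

    πd≡πe : π d ≡ π e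
    πd≡πe = begin
      π d                                              ≡⟨ undo d ⟩
      π (a ℕ.* ℕ.pred m ℕ.+ (d ℕ.+ a))                 ≡⟨ π-+-toℕ-π _ (d ℕ.+ a) ⟨
      π (a ℕ.* ℕ.pred m ℕ.+ toℕ (π (d ℕ.+ a)))         ≡⟨ cong (λ z → π (a ℕ.* ℕ.pred m ℕ.+ toℕ z)) eq ⟩
      π (a ℕ.* ℕ.pred m ℕ.+ toℕ (π (e ℕ.+ a)))         ≡⟨ π-+-toℕ-π _ (e ℕ.+ a) ⟩
      π (a ℕ.* ℕ.pred m ℕ.+ (e ℕ.+ a))                 ≡⟨ undo e ⟨
      π e                                              ∎

  Next⇒≡π : ∀ {x y} → Next x y → y ≡ π (suc (toℕ x))
  Next⇒≡π {x} {y} (inj₁ y≡1+x) = trans (sym (π-toℕ y)) (cong π y≡1+x)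
  Next⇒≡π {x} {y} (inj₂ (1+x≡m , y≡0)) = Fin.toℕ-injective (begin
    toℕ y                      ≡⟨ y≡0 ⟩
    0                          ≡⟨ ℕ.n%n≡0 m ⟨
    m ℕ.% m                    ≡⟨ cong (ℕ._% m) 1+x≡m ⟨
    suc (toℕ x) ℕ.% m          ≡⟨ toℕ-π (suc (toℕ x)) ⟨
    toℕ (π (suc (toℕ x)))      ∎)

  Next-π : ∀ x → Next x (π (suc (toℕ x)))
  Next-π x with ℕ.m≤n⇒m<n∨m≡n (Fin.toℕ<n x)
  ... | inj₁ 1+x<m = inj₁ (toℕ-π-< 1+x<m)
  ... | inj₂ 1+x≡m = inj₂ (1+x≡m , trans (toℕ-π _) (trans (cong (ℕ._% m) 1+x≡m) (ℕ.n%n≡0 m)))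

module CycleWalks (m : ℕ) .{{_ : NonZero m}} (3≤m : 3 ≤ m) where

  open Residues m

  walk-forward : ∀ k a → Walk (cycle m 3≤m) k (π a) (π (k ℕ.+ a))
  walk-forward zero    a = refl
  walk-forward (suc k) a = π (suc a) ,
    inj₁ (subst (Next (π a)) (π-+-toℕ-π 1 a) (Next-π (π a))) ,
    subst (Walk (cycle m 3≤m) k (π (suc a)) ∘ π) (ℕ.+-suc k a) (walk-forward k (suc a))

  -- From `d + a`, going forward `m − d` steps closes the circle at `a`; the required walk is the
  -- reverse.
  walk-around : ∀ {d} a → d ≤ m → Walk (cycle m 3≤m) (m ℕ.∸ d) (π a) (π (d ℕ.+ a))
  walk-around {d} a d≤m = walk-sym (cycle m 3≤m) (m ℕ.∸ d)
    (subst (Walk (cycle m 3≤m) (m ℕ.∸ d) (π (d ℕ.+ a))) eq (walk-forward (m ℕ.∸ d) (d ℕ.+ a)))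
    where
    eq : π (m ℕ.∸ d ℕ.+ (d ℕ.+ a)) ≡ π a
    eq = trans (cong π (trans (sym (ℕ.+-assoc (m ℕ.∸ d) d a)) (cong (ℕ._+ a) (ℕ.m∸n+n≡m d≤m)))) (π-+m a)

  -- Induction on the walk: the offset `d` is reached either forwards, with `d ≤ k`, or backwards,
  -- with `m − d ≤ k`. The second bound is written additively to avoid truncated subtraction.
  walk-offset : ∀ k {x y} → Walk (cycle m 3≤m) k x y →
    ∃ λ d → d < m × (d ≤ k ⊎ m ≤ d ℕ.+ k) × y ≡ π (d ℕ.+ toℕ x)
  walk-offset zero {x} refl = 0 , >-nonZero⁻¹ m , inj₁ z≤n , sym (π-toℕ x)
  walk-offset (suc k) {x} {y} (z , x~z , w) with walk-offset k w
  walk-offset (suc k) {x} {y} (z , inj₁ x→z , w) | d , d<m , bound , y≡ = forward (ℕ.m≤n⇒m<n∨m≡n d<m)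
    where
    y≡′ : y ≡ π (suc d ℕ.+ toℕ x)
    y≡′ = begin
      y                                     ≡⟨ y≡ ⟩
      π (d ℕ.+ toℕ z)                       ≡⟨ cong (λ z → π (d ℕ.+ toℕ z)) (Next⇒≡π x→z) ⟩
      π (d ℕ.+ toℕ (π (suc (toℕ x))))       ≡⟨ π-+-toℕ-π d (suc (toℕ x)) ⟩
      π (d ℕ.+ suc (toℕ x))                 ≡⟨ cong π (ℕ.+-suc d (toℕ x)) ⟩
      π (suc d ℕ.+ toℕ x)                   ∎

    forward : suc d < m ⊎ suc d ≡ m →
      ∃ λ d → d < m × (d ≤ suc k ⊎ m ≤ d ℕ.+ suc k) × y ≡ π (d ℕ.+ toℕ x)
    forward (inj₁ 1+d<m) = suc d , 1+d<m ,
      [ inj₁ ∘ s≤s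
      , (λ m≤d+k → inj₂ (ℕ.≤-trans m≤d+k (ℕ.+-mono-≤ (ℕ.n≤1+n d) (ℕ.n≤1+n k)))) ]′ bound ,
      y≡′
    -- The offset completes a full turn and restarts at 0, where the forward bound is trivial.
    forward (inj₂ 1+d≡m) = 0 , >-nonZero⁻¹ m , inj₁ z≤n ,
      trans y≡′ (trans (cong (λ d → π (d ℕ.+ toℕ x)) 1+d≡m) (π-+m (toℕ x)))
  walk-offset (suc k) {x} {y} (z , inj₂ z→x , w) | suc d , d<m , bound , y≡ =
    d , ℕ.<-trans (ℕ.n<1+n d) d<m ,
    [ (λ d≤k → inj₁ (ℕ.≤-trans (ℕ.n≤1+n d) (ℕ.m≤n⇒m≤1+n d≤k)))
    , inj₂ ∘ subst (m ≤_) (sym (ℕ.+-suc d k)) ]′ bound ,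
    (begin
      y                                   ≡⟨ y≡ ⟩
      π (suc d ℕ.+ toℕ z)                 ≡⟨ cong π (ℕ.+-suc d (toℕ z)) ⟨
      π (d ℕ.+ suc (toℕ z))               ≡⟨ π-+-toℕ-π d (suc (toℕ z)) ⟨
      π (d ℕ.+ toℕ (π (suc (toℕ z))))     ≡⟨ cong (λ x → π (d ℕ.+ toℕ x)) (Next⇒≡π z→x) ⟨
      π (d ℕ.+ toℕ x)                     ∎)
  -- Stepping back from offset 0 wraps round to `m − 1`, which a single backward step already
  -- accounts for.
  walk-offset (suc k) {x} {y} (z , inj₂ z→x , w) | zero , d<m , bound , y≡ =
    ℕ.pred m , ℕ.≤-reflexive (ℕ.suc-pred m) ,
    inj₂ (ℕ.≤-trans (ℕ.≤-reflexive (sym (ℕ.suc-pred m)))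
      (ℕ.≤-trans (s≤s (ℕ.m≤m+n (ℕ.pred m) k)) (ℕ.≤-reflexive (sym (ℕ.+-suc (ℕ.pred m) k))))) ,
    (begin
      y                                             ≡⟨ y≡ ⟩
      π (toℕ z)                                     ≡⟨ π-+m (toℕ z) ⟨
      π (m ℕ.+ toℕ z)                               ≡⟨ cong (λ m → π (m ℕ.+ toℕ z)) (ℕ.suc-pred m) ⟨
      π (suc (ℕ.pred m) ℕ.+ toℕ z)                  ≡⟨ cong π (ℕ.+-suc (ℕ.pred m) (toℕ z)) ⟨
      π (ℕ.pred m ℕ.+ suc (toℕ z))                  ≡⟨ π-+-toℕ-π (ℕ.pred m) (suc (toℕ z)) ⟨
      π (ℕ.pred m ℕ.+ toℕ (π (suc (toℕ z))))        ≡⟨ cong (λ x → π (ℕ.pred m ℕ.+ toℕ x)) (Next⇒≡π z→x) ⟨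
      π (ℕ.pred m ℕ.+ toℕ x)                        ∎)

  walk-length : ∀ k {d x} → d < m → Walk (cycle m 3≤m) k x (π (d ℕ.+ toℕ x)) → d ≤ k ⊎ m ≤ d ℕ.+ k
  walk-length k {d} {x} d<m w with walk-offset k w
  ... | e , e<m , bound , eq with π-injective (toℕ x) d<m e<m eq
  ... | refl = bound

-- The graph C(2n,r)

module CirculantGraph (n r : ℕ) (1≤r : 1 ≤ r) (r<n : r < n) where

  private
    2n = 2 ℕ.* n

    2n≡n+n : 2n ≡ n ℕ.+ n
    2n≡n+n = cong (n ℕ.+_) (ℕ.+-identityʳ n)

    0<n : 0 < n
    0<n = ℕ.≤-trans z<s r<n

    n<2n : n < 2n
    n<2n = subst (n <_) (sym 2n≡n+n) (ℕ.m<m+n n 0<n)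

    instance
      2n≢0 : NonZero 2n
      2n≢0 = >-nonZero (ℕ.<-trans 0<n n<2n)

  open Residues 2n
  open CycleWalks 2n (ℕ.≤-trans (ℕ.n≤1+n 3) (ℕ.*-monoʳ-≤ 2 (ℕ.≤-trans (s≤s 1≤r) r<n)))

  -- For `d < 2n`, these are the positions of the ones in the first row of the circulant matrix. The
  -- last case says that the way round, of length `2n − d`, has at most `r` edges.
  Offset : ℕ → Set
  Offset d = (0 < d × d ≤ r) ⊎ d ≡ n ⊎ 2n ≤ d ℕ.+ r

  private
    G = C[2n,r] n r 1≤r r<n
    H = C₂ₙ n r 1≤r r<n
    A = adjacencyMatrix G

    forward : ∀ d x → Walk H d x (π (d ℕ.+ toℕ x))
    forward d x = subst (λ z → Walk H d z (π (d ℕ.+ toℕ x))) (π-toℕ x) (walk-forward d (toℕ x))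

    around : ∀ {d} x → d < 2n → Walk H (2n ℕ.∸ d) x (π (d ℕ.+ toℕ x))
    around {d} x d<2n = subst (λ z → Walk H (2n ℕ.∸ d) z (π (d ℕ.+ toℕ x))) (π-toℕ x)
      (walk-around (toℕ x) (ℕ.<⇒≤ d<2n))

    distinct : ∀ {d} x → 0 < d → d < 2n → x ≢ π (d ℕ.+ toℕ x)
    distinct x 0<d d<2n x≡ = ℕ.<⇒≢ 0<d
      (π-injective (toℕ x) (ℕ.<-trans 0<n n<2n) d<2n (trans (π-toℕ x) x≡))

  offset⇒adj : ∀ x {d} → d < 2n → Offset d → Adj G x (π (d ℕ.+ toℕ x))
  offset⇒adj x {d} d<2n (inj₁ (0<d , d≤r)) =
    inj₁ (distinct x 0<d d<2n , walk⇒distanceAtMost H r d≤r (forward d x))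
  offset⇒adj x {d} d<2n (inj₂ (inj₁ refl)) = inj₂ (forward d x , minimal)
    where
    minimal : ∀ {k} → k < n → ¬ Walk H k x (π (n ℕ.+ toℕ x))
    minimal {k} k<n w with walk-length k d<2n w
    ... | inj₁ n≤k    = ℕ.<⇒≱ k<n n≤k
    ... | inj₂ 2n≤n+k = ℕ.<⇒≱ k<n (ℕ.+-cancelˡ-≤ n n k (subst (_≤ n ℕ.+ k) 2n≡n+n 2n≤n+k))
  offset⇒adj x {d} d<2n (inj₂ (inj₂ 2n≤d+r)) = inj₁
    ( distinct x (ℕ.n≢0⇒n>0 λ { refl → ℕ.<⇒≱ (ℕ.<-trans r<n n<2n) 2n≤d+r }) d<2n
    , walk⇒distanceAtMost H r (ℕ.m≤n+o⇒m∸n≤o 2n d 2n≤d+r) (around x d<2n))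

  adj⇒offset : ∀ x {d} → d < 2n → Adj G x (π (d ℕ.+ toℕ x)) → Offset d
  adj⇒offset x {zero} d<2n (inj₁ (x≢y , _)) = contradiction (sym (π-toℕ x)) x≢y
  adj⇒offset x {suc d} d<2n (inj₁ (x≢y , k , k≤r , w , _)) with walk-length k d<2n w
  ... | inj₁ d≤k    = inj₁ (z<s , ℕ.≤-trans d≤k k≤r)
  ... | inj₂ 2n≤d+k = inj₂ (inj₂ (ℕ.≤-trans 2n≤d+k (ℕ.+-monoʳ-≤ (suc d) k≤r)))
  -- Any offset other than `n` gives a walk shorter than `n`: the way round if `d` is larger, the
  -- forward walk if it is smaller.
  adj⇒offset x {d} d<2n (inj₂ (w , min)) = inj₂ (inj₁ (ℕ.≤-antisym
    (ℕ.≮⇒≥ λ n<d → min (2n∸d<n n<d) (around x d<2n))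
    (ℕ.≮⇒≥ λ d<n → min d<n (forward d x))))
    where
    2n∸d<n : n < d → 2n ℕ.∸ d < n
    2n∸d<n n<d = subst (2n ℕ.∸ d <_) (trans (cong (ℕ._∸ n) 2n≡n+n) (ℕ.m+n∸n≡m n n))
      (ℕ.∸-monoʳ-< n<d (ℕ.<⇒≤ d<2n))

  entry-one : ∀ x {d} → d < 2n → Offset d → A x (π (d ℕ.+ toℕ x)) ≡ 1ℚ
  entry-one x {d} d<2n off = cong (λ b → if b then 1ℚ else 0ℚ)
    (dec-true (adj? G x (π (d ℕ.+ toℕ x))) (offset⇒adj x d<2n off))

  entry-zero : ∀ x {d} → d < 2n → ¬ Offset d → A x (π (d ℕ.+ toℕ x)) ≡ 0ℚ
  entry-zero x {d} d<2n ¬off = cong (λ b → if b then 1ℚ else 0ℚ)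
    (dec-false (adj? G x (π (d ℕ.+ toℕ x))) (¬off ∘ adj⇒offset x d<2n))

  private
    r′ = 2n ℕ.∸ r
    q  = n ℕ.∸ suc r

    n≤2n : n ≤ 2n
    n≤2n = ℕ.m≤m+n n _

    n≡ : suc r ℕ.+ q ≡ n
    n≡ = ℕ.m+[n∸m]≡n r<n

    2n≡ : r′ ℕ.+ r ≡ 2n
    2n≡ = ℕ.m∸n+n≡m (ℕ.≤-trans (ℕ.<⇒≤ r<n) n≤2n)

    r′≡ : n ℕ.+ suc q ≡ r′
    r′≡ = ℕ.+-cancelʳ-≡ r _ _ (trans (lemma n q r) (trans (cong (n ℕ.+_) n≡)
      (trans (cong (n ℕ.+_) (sym (ℕ.+-identityʳ n))) (sym 2n≡))))
      where
      lemma : ∀ n q r → (n ℕ.+ suc q) ℕ.+ r ≡ n ℕ.+ (suc r ℕ.+ q)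
      lemma = ℕ.solve-∀

  -- Re-indexing by the offset from `x` turns row `x` into the first row of the circulant. It splits
  -- into six blocks: the diagonal zero, `r` ones, `q` zeros, the antipodal one, `q` zeros and `r`
  -- ones.
  adjacencyMatrix-*ᵛ : ∀ {h} → Periodic 2n h → ∀ x →
    (A *ᵛ (h ∘ toℕ)) x ≡ circulant n r r′ h (toℕ x)
  adjacencyMatrix-*ᵛ {h} per x = begin
    sum (λ j → A x j * h (toℕ j))
      ≡⟨ sum-cong-≗ (λ j → cong (λ j′ → A x j′ * h (toℕ j)) (sym (π-toℕ j))) ⟩
    ∑< 2n e
      ≡⟨ ∑<-periodic e-periodic (toℕ x) ⟨
    ∑< 2n g
      ≡⟨ split ⟩
    (((g 0 + ∑< r (g ∘ suc)) + ∑< q (λ k → g (suc r ℕ.+ k)))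
      + (g (n ℕ.+ 0) + ∑< q (λ k → g (n ℕ.+ suc k)))) + ∑< r (λ k → g (r′ ℕ.+ k))
      ≡⟨ cong₂ _+_ (cong₂ _+_ (cong₂ _+_ (cong₂ _+_ block₀ block₁) block₂)
           (cong₂ _+_ block₃ block₄)) block₅ ⟩
    (((0ℚ + S₁) + 0ℚ) + (h (n ℕ.+ toℕ x) + 0ℚ)) + S₂
      -- The diagonal term is added and subtracted, which joins the two blocks of ones into one
      -- window of `2r + 1` consecutive terms centred at `x`.
      ≡⟨ solve 4 (λ S₁ S₂ a b → (((con 0ℚ :+ S₁) :+ con 0ℚ) :+ (a :+ con 0ℚ)) :+ S₂ :=
           ((S₂ :+ (b :+ S₁)) :- b) :+ a) refl S₁ S₂ (h (n ℕ.+ toℕ x)) (h (toℕ x)) ⟩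
    ((S₂ + (h (toℕ x) + S₁)) - h (toℕ x)) + h (n ℕ.+ toℕ x)
      ≡⟨ cong (λ S → (S - h (toℕ x)) + h (n ℕ.+ toℕ x)) window ⟨
    circulant n r r′ h (toℕ x) ∎
    where
    e : ℕ → ℚ
    e k = A x (π k) * h k

    e-periodic : Periodic 2n e
    e-periodic k = cong₂ _*_ (cong (A x) (π-+m k)) (per k)

    g : ℕ → ℚ
    g d = e (d ℕ.+ toℕ x)

    S₁ = ∑< r λ k → h (suc k ℕ.+ toℕ x)
    S₂ = ∑< r λ k → h (k ℕ.+ (r′ ℕ.+ toℕ x))

    split : ∑< 2n g ≡
      (((g 0 + ∑< r (g ∘ suc)) + ∑< q (λ k → g (suc r ℕ.+ k)))
        + (g (n ℕ.+ 0) + ∑< q (λ k → g (n ℕ.+ suc k)))) + ∑< r (λ k → g (r′ ℕ.+ k))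
    split = begin
      ∑< 2n g
        ≡⟨ cong (λ l → ∑< l g) 2n≡ ⟨
      ∑< (r′ ℕ.+ r) g
        ≡⟨ ∑<-+ r′ r g ⟩
      ∑< r′ g + ∑< r (λ k → g (r′ ℕ.+ k))
        ≡⟨ cong (_+ ∑< r (λ k → g (r′ ℕ.+ k)))
             (trans (cong (λ l → ∑< l g) (sym r′≡)) (∑<-+ n (suc q) g)) ⟩
      (∑< n g + ∑< (suc q) (λ k → g (n ℕ.+ k))) + ∑< r (λ k → g (r′ ℕ.+ k))
        ≡⟨ cong (λ S → (S + ∑< (suc q) (λ k → g (n ℕ.+ k))) + ∑< r (λ k → g (r′ ℕ.+ k)))
             (trans (cong (λ l → ∑< l g) (sym n≡)) (∑<-+ (suc r) q g)) ⟩
      (((g 0 + ∑< r (g ∘ suc)) + ∑< q (λ k → g (suc r ℕ.+ k)))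
        + (g (n ℕ.+ 0) + ∑< q (λ k → g (n ℕ.+ suc k)))) + ∑< r (λ k → g (r′ ℕ.+ k)) ∎

    g-one : ∀ {d} → d < 2n → Offset d → g d ≡ h (d ℕ.+ toℕ x)
    g-one {d} d<2n off = trans (cong (_* h (d ℕ.+ toℕ x)) (entry-one x d<2n off)) (ℚ.*-identityˡ _)

    g-zero : ∀ {d} → d < 2n → ¬ Offset d → g d ≡ 0ℚ
    g-zero {d} d<2n ¬off = trans (cong (_* h (d ℕ.+ toℕ x)) (entry-zero x d<2n ¬off))
      (ℚ.*-zeroˡ (h (d ℕ.+ toℕ x)))

    ¬offset : ∀ {d} → ¬ (0 < d × d ≤ r) → d ≢ n → d < r′ → ¬ Offset d
    ¬offset ¬near d≢n d<r′ (inj₁ near)            = ¬near near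
    ¬offset ¬near d≢n d<r′ (inj₂ (inj₁ d≡n))      = d≢n d≡n
    ¬offset ¬near d≢n d<r′ (inj₂ (inj₂ 2n≤d+r))   =
      ℕ.<⇒≱ d<r′ (ℕ.+-cancelʳ-≤ r r′ _ (ℕ.≤-trans (ℕ.≤-reflexive 2n≡) 2n≤d+r))

    r′≤2n : r′ ≤ 2n
    r′≤2n = ℕ.m∸n≤m 2n r

    n<r′ : n < r′
    n<r′ = subst (n <_) r′≡ (ℕ.m<m+n n z<s)

    block₀ : g 0 ≡ 0ℚ
    block₀ = g-zero (ℕ.≤-trans 0<r′ r′≤2n) (¬offset (λ ()) (ℕ.<⇒≢ (ℕ.≤-trans z<s r<n)) 0<r′)
      where
      0<r′ : 0 < r′
      0<r′ = ℕ.≤-trans z<s n<r′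

    block₁ : ∑< r (g ∘ suc) ≡ S₁
    block₁ = ∑<-cong-< r λ k k<r → g-one (ℕ.≤-trans (s≤s k<r) (ℕ.≤-trans r<n n≤2n)) (inj₁ (z<s , k<r))

    block₂ : ∑< q (λ k → g (suc r ℕ.+ k)) ≡ 0ℚ
    block₂ = ∑<-zero q λ k k<q →
      let d<n = ℕ.≤-trans (ℕ.+-monoʳ-< (suc r) k<q) (ℕ.≤-reflexive n≡) in
      g-zero (ℕ.≤-trans d<n n≤2n)
        (¬offset (λ (_ , d≤r) → ℕ.m+n≮m r k d≤r) (ℕ.<⇒≢ d<n) (ℕ.<-trans d<n n<r′))

    block₃ : g (n ℕ.+ 0) ≡ h (n ℕ.+ toℕ x)
    block₃ = trans (cong g (ℕ.+-identityʳ n)) (g-one (ℕ.≤-trans n<r′ r′≤2n) (inj₂ (inj₁ refl)))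

    block₄ : ∑< q (λ k → g (n ℕ.+ suc k)) ≡ 0ℚ
    block₄ = ∑<-zero q λ k k<q →
      let d<r′ = ℕ.≤-trans (ℕ.+-monoʳ-< n (s<s k<q)) (ℕ.≤-reflexive r′≡)
          n<d  = ℕ.m<m+n n z<s in
      g-zero (ℕ.≤-trans d<r′ r′≤2n)
        (¬offset (λ (_ , d≤r) → ℕ.<⇒≱ (ℕ.<-trans r<n n<d) d≤r) (≢-sym (ℕ.<⇒≢ n<d)) d<r′)

    block₅ : ∑< r (λ k → g (r′ ℕ.+ k)) ≡ S₂
    block₅ = ∑<-cong-< r λ k k<r → trans
      (g-one (ℕ.≤-trans (ℕ.+-monoʳ-< r′ k<r) (ℕ.≤-reflexive 2n≡))
        (inj₂ (inj₂ (ℕ.≤-trans (ℕ.≤-reflexive (sym 2n≡)) (ℕ.+-monoˡ-≤ r (ℕ.m≤m+n r′ k))))))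
      (cong h (lemma r′ k (toℕ x)))
      where
      lemma : ∀ r′ k x → (r′ ℕ.+ k) ℕ.+ x ≡ k ℕ.+ (r′ ℕ.+ x)
      lemma = ℕ.solve-∀

    window : ∑< (2 ℕ.* r ℕ.+ 1) (λ k → h (k ℕ.+ (r′ ℕ.+ toℕ x))) ≡ S₂ + (h (toℕ x) + S₁)
    window = begin
      ∑< (2 ℕ.* r ℕ.+ 1) w            ≡⟨ cong (λ l → ∑< l w) (length r) ⟩
      ∑< (r ℕ.+ suc r) w              ≡⟨ ∑<-+ r (suc r) w ⟩
      S₂ + ∑< (suc r) (λ k → w (r ℕ.+ k))
        ≡⟨ cong (S₂ +_) (∑<-cong (suc r) λ k → trans
             (cong h (trans (lemma r r′ k (toℕ x)) (cong (ℕ._+ (k ℕ.+ toℕ x)) 2n≡)))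
             (per (k ℕ.+ toℕ x))) ⟩
      S₂ + (h (toℕ x) + S₁) ∎
      where
      w : ℕ → ℚ
      w k = h (k ℕ.+ (r′ ℕ.+ toℕ x))

      length : ∀ r → 2 ℕ.* r ℕ.+ 1 ≡ r ℕ.+ suc r
      length = ℕ.solve-∀

      lemma : ∀ r r′ k x → (r ℕ.+ k) ℕ.+ (r′ ℕ.+ x) ≡ (r′ ℕ.+ r) ℕ.+ (k ℕ.+ x)
      lemma = ℕ.solve-∀

  -- The two implications

  3≤gcd⇒singular : 3 ≤ gcd n (2 ℕ.* r ℕ.+ 1) → Singular G
  3≤gcd⇒singular 3≤d = kernel⇒singular A (v ∘ toℕ) (π 0) kernel nonzero
    where
    d = gcd n (2 ℕ.* r ℕ.+ 1)

    open DivisibilityIndicator d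

    v : ℕ → ℚ
    v j = indicator j - indicator (suc j)

    n-periodic : Periodic n indicator
    n-periodic = indicator-periodic (gcd[m,n]∣m n (2 ℕ.* r ℕ.+ 1))

    v-periodic : Periodic n v
    v-periodic i = cong₂ _-_ (n-periodic i) (trans (cong indicator (sym (ℕ.+-suc n i))) (n-periodic (suc i)))

    kernel : A *ᵛ (v ∘ toℕ) ≗ (λ _ → 0ℚ)
    kernel x = begin
      (A *ᵛ (v ∘ toℕ)) x
        ≡⟨ adjacencyMatrix-*ᵛ (Periodic-* v-periodic 2) x ⟩
      (∑< (2 ℕ.* r ℕ.+ 1) (λ k → v (k ℕ.+ c)) - v (toℕ x)) + v (n ℕ.+ toℕ x)
        ≡⟨ cong₂ (λ a b → (a - v (toℕ x)) + b)
             (∑<-telescope indicator (2 ℕ.* r ℕ.+ 1) c) (v-periodic (toℕ x)) ⟩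
      ((indicator c - indicator (2 ℕ.* r ℕ.+ 1 ℕ.+ c)) - v (toℕ x)) + v (toℕ x)
        ≡⟨ cong (λ a → ((indicator c - a) - v (toℕ x)) + v (toℕ x))
             (indicator-periodic (gcd[m,n]∣n n (2 ℕ.* r ℕ.+ 1)) c) ⟩
      ((indicator c - indicator c) - v (toℕ x)) + v (toℕ x)
        ≡⟨ solve 2 (λ a b → ((a :- a) :- b) :+ b := con 0ℚ) refl (indicator c) (v (toℕ x)) ⟩
      0ℚ ∎
      where
      c = r′ ℕ.+ toℕ x

    -- `d` divides 0 but not 1, so the kernel vector starts with `1 - 0`.
    v₀≡1 : v 0 ≡ 1ℚ
    v₀≡1 = cong₂ _-_ (indicator-∣ (d ∣0)) (indicator-∤ λ d∣1 →
      ℕ.<⇒≱ (ℕ.≤-trans (s≤s (s≤s z≤n)) 3≤d) (∣⇒≤ d∣1))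

    nonzero : v (toℕ (π 0)) ≢ 0ℚ
    nonzero v≡0 with trans (sym v₀≡1) (trans (cong v (sym (toℕ-π-< (ℕ.≤-trans 0<n n≤2n)))) v≡0)
    ... | ()

  gcd<3⇒invertible : ¬ 3 ≤ gcd n (2 ℕ.* r ℕ.+ 1) → Invertible A
  gcd<3⇒invertible gcd≱3 = symmetric∧surjective⇒invertible A (adjacencyMatrix-sym G) surjective
    where
    inverse = odd-inverse r (coprime-4n n r gcd≱3)
    s       = proj₁ inverse
    t       = proj₁ (proj₂ inverse)

    open Operators n r s t

    -- The preimage is `U(1 + DU)h`, where `h` is the periodic extension of a solution `y` of
    -- `(1 + 2C)y = b`. Elimination supplies `y`, as this system is the identity modulo 2.
    surjective : ∀ b → ∃ λ x → A *ᵛ x ≗ b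
    surjective b = U (h ⊕ D (U h)) ∘ toℕ , λ i → begin
      (A *ᵛ (U (h ⊕ D (U h)) ∘ toℕ)) i
        ≡⟨ adjacencyMatrix-*ᵛ (U-periodic λ k →
             cong₂ _+_ (h-periodic k) (D-periodic (U-periodic h-periodic) k)) i ⟩
      circulant n r r′ (U (h ⊕ D (U h))) (toℕ i)
        ≡⟨ circulant-U 2n≡ (proj₂ (proj₂ inverse)) h-periodic (toℕ i) ⟩
      h (toℕ i) + (C h (toℕ i) + C h (toℕ i))
        ≡⟨ cong (λ j → y j + (C h (toℕ i) + C h (toℕ i))) (π-toℕ i) ⟩
      y i + (C h (toℕ i) + C h (toℕ i))
        ≡⟨ proj₂ solution i ⟩
      b i ∎
      where
      solution = 1+φ+φ-surjective (λ i y → C (y ∘ π) (toℕ i))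
        (λ i → C-isIntegral (λ k → lookup-isIntegral (π k)) (toℕ i)) b

      y = proj₁ solution

      h : ℕ → ℚ
      h = y ∘ π

      h-periodic : Periodic 2n h
      h-periodic k = cong y (π-+m k)

theorem20 : (n r : ℕ) (1≤r : 1 ≤ r) (r<n : r < n) →
    Singular (C[2n,r] n r 1≤r r<n) ⇔ 3 ≤ gcd n (2 ℕ.* r ℕ.+ 1)
theorem20 n r 1≤r r<n = mk⇔
  -- Singularity is a negation, so this direction is a contrapositive, and decidability of the
  -- inequality removes the double negation.
  (λ singular → decidable-stable (3 ℕ.≤? gcd n (2 ℕ.* r ℕ.+ 1)) (singular ∘ gcd<3⇒invertible))
  3≤gcd⇒singular
  where open CirculantGraph n r 1≤r r<n
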